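{- A cograph $G$ is partitionable if and only if $G$ contains none of the following graphs as an induced subgraph: $H_1 = 2K_1 \oplus 2K_1 \oplus 2K_1 \oplus K_1$; $H_2 = P_3 \oplus K_1 \oplus 2K_2$; $H_3 = 2K_1 \oplus (K_2 \cup K_1) \oplus (K_2 \cup K_1)$; $H_4 = P_3 \oplus (K_2 \cup P_3)$; $H_5 = (K_2 \cup K_1) \oplus K_1 \oplus 2K_2$; $H_6 = (K_2 \cup K_1) \oplus (K_3 \cup P_3)$; $H_7 = (K_2 \cup K_1) \oplus (K_2 \cup (P_3 \oplus K_1))$; $H_8 = (K_2 \cup K_1) \oplus (K_2 \cup (K_1 \oplus (K_2 \cup K_1)))$; $H_9 = K_1 \oplus (K_3 \cup (C_4 \oplus K_1))$; $H_{10} = K_1 \oplus (K_3 \cup (K_1 \oplus (P_3 \cup K_2)))$; $H_{11} = K_1 \oplus (K_3 \cup (K_2 \oplus 2K_2))$; $H_{12} = K_1 \oplus (K_3 \cup ((K_2 \cup K_1) \oplus (K_2 \cup K_1)))$; $H_{13} = K_2 \oplus (P_3 \cup 2K_3)$; $H_{14} = K_2 \oplus (K_3 \cup (P_3 \oplus K_1))$; $H_{15} = K_2 \oplus (K_3 \cup (K_1 \oplus (K_1 \cup K_2)))$; $H_{16} = (K_3 \cup K_2) \oplus (K_3 \cup K_1)$; $H_{17} = K_3 \oplus 2K_3$.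
   Context: All graphs are finite, simple and loopless. A cograph is a graph with no induced subgraph isomorphic to $P_4$ (the path on four vertices). A graph $G=(V,E)$ is partitionable if there exists a partition $\{A,B\}$ of $V$ such that $G[A]$ is a disjoint union of cliques with no edges between them (equivalently $G[A]$ has no induced $P_3$) and $G[B]$ is triangle-free. $K_n$, $C_n$, $P_n$ denote the complete graph, cycle and path on $n$ vertices. $G \cup H$ is the disjoint union of $G$ and $H$; $kG$ is the disjoint union of $k$ copies of $G$. The join $G \oplus H$ is obtained from the disjoint union of $G$ and $H$ by adding all edges between a vertex of $G$ and a vertex of $H$; $A \oplus B \oplus C = (A\oplus B)\oplus C$. "Contains" means contains as an induced subgraph. -}

module Defs where

open import Data.Nat using (ℕ; zero; suc; _+_)
import Data.Nat as ℕ
open import Data.Nat.Properties using (1+n≢n)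
open import Data.Fin using (Fin; toℕ; splitAt; _≟_)
open import Data.Sum using (_⊎_; inj₁; inj₂)
open import Data.Bool using (Bool; true; false; _∨_; _∧_; not; T)
open import Data.Bool.Properties using (∨-comm)
open import Data.Product using (Σ; _×_; _,_)
open import Relation.Nullary using (¬_; does; yes; no)
open import Relation.Nullary.Decidable using (dec-false)
open import Relation.Binary.PropositionalEquality using (_≡_; refl; sym; cong; cong₂)
open import Function.Definitions using (Injective)

record Graph : Set where
  field
    size   : ℕ
    adj    : Fin size → Fin size → Bool
    adj-sym : ∀ i j → adj i j ≡ adj j i
    irrefl : ∀ i → adj i i ≡ false
open Graph public

ContainsIn : (G : Graph) → (Fin (size G) → Bool) → Graph → Set
ContainsIn G S H =
  Σ (Fin (size H) → Fin (size G)) λ f →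
    Injective _≡_ _≡_ f
    × (∀ i → S (f i) ≡ true)
    × (∀ i j → adj H i j ≡ adj G (f i) (f j))

Contains : Graph → Graph → Set
Contains G H =
  Σ (Fin (size H) → Fin (size G)) λ f →
    Injective _≡_ _≡_ f
    × (∀ i j → adj H i j ≡ adj G (f i) (f j))

private
  eqF : ∀ {n} (i j : Fin n) → Bool
  eqF i j = does (i ≟ j)

  eqF-sym : ∀ {n} (i j : Fin n) → eqF i j ≡ eqF j i
  eqF-sym i j with i ≟ j | j ≟ i
  ... | yes _ | yes _ = refl
  ... | no _  | no _  = refl
  ... | yes p | no q  = Data.Empty.⊥-elim (q (sym p))
    where import Data.Empty
  ... | no p  | yes q = Data.Empty.⊥-elim (p (sym q))
    where import Data.Empty

  eqF-refl : ∀ {n} (i : Fin n) → eqF i i ≡ true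
  eqF-refl i with i ≟ i
  ... | yes _ = refl
  ... | no p  = Data.Empty.⊥-elim (p refl)
    where import Data.Empty

  eqN : ℕ → ℕ → Bool
  eqN m n = does (m ℕ.≟ n)

  succ≢ : ∀ k → eqN (suc k) k ≡ false
  succ≢ k = dec-false (suc k ℕ.≟ k) 1+n≢n

K : ℕ → Graph
K n = record
  { size = n
  ; adj = λ i j → not (eqF i j)
  ; adj-sym = λ i j → cong not (eqF-sym i j)
  ; irrefl = λ i → cong not (eqF-refl i)
  }

private
  pathAdj : ∀ {n} → Fin n → Fin n → Bool
  pathAdj i j = eqN (suc (toℕ i)) (toℕ j) ∨ eqN (suc (toℕ j)) (toℕ i)

  pathAdj-irrefl : ∀ {n} (i : Fin n) → pathAdj i i ≡ false
  pathAdj-irrefl i rewrite succ≢ (toℕ i) = refl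

P : ℕ → Graph
P n = record
  { size = n
  ; adj = pathAdj {n}
  ; adj-sym = λ (i j : Fin n) → ∨-comm (eqN (suc (toℕ i)) (toℕ j)) (eqN (suc (toℕ j)) (toℕ i))
  ; irrefl = pathAdj-irrefl {n}
  }

private
  endAdj : ℕ → ℕ → ℕ → Bool
  endAdj last a b = (eqN a 0 ∧ eqN b last) ∨ (eqN b 0 ∧ eqN a last)

  endAdj-sym : ∀ l a b → endAdj l a b ≡ endAdj l b a
  endAdj-sym l a b = ∨-comm (eqN a 0 ∧ eqN b l) (eqN b 0 ∧ eqN a l)

  endAdj-irrefl : ∀ k a → endAdj (suc (suc k)) a a ≡ false
  endAdj-irrefl k zero = refl
  endAdj-irrefl k (suc a) = refl

-- Cycle on k + 3 vertices: the path P_{k+3} plus the edge {0, k+2}.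
-- (Cycles are only defined for at least 3 vertices; C_n = Cyc (n ∸ 3).)
Cyc : ℕ → Graph
Cyc k = record
  { size = suc (suc (suc k))
  ; adj = λ i j → pathAdj i j ∨ endAdj (suc (suc k)) (toℕ i) (toℕ j)
  ; adj-sym = λ i j → cong₂ _∨_ (Graph.adj-sym (P (suc (suc (suc k)))) i j)
                            (endAdj-sym (suc (suc k)) (toℕ i) (toℕ j))
  ; irrefl = λ i → cong₂ _∨_ (pathAdj-irrefl i) (endAdj-irrefl k (toℕ i))
  }

C₄ : Graph
C₄ = Cyc 1

private
  comb : ∀ m n → Bool → (Fin m → Fin m → Bool) → (Fin n → Fin n → Bool)
       → Fin (m + n) → Fin (m + n) → Bool
  comb m n c a b i j with splitAt m i | splitAt m j
  ... | inj₁ x | inj₁ y = a x y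
  ... | inj₂ x | inj₂ y = b x y
  ... | inj₁ _ | inj₂ _ = c
  ... | inj₂ _ | inj₁ _ = c

  comb-sym : ∀ m n c (a : Fin m → Fin m → Bool) (b : Fin n → Fin n → Bool)
           → (∀ x y → a x y ≡ a y x) → (∀ x y → b x y ≡ b y x)
           → ∀ i j → comb m n c a b i j ≡ comb m n c a b j i
  comb-sym m n c a b sa sb i j with splitAt m i | splitAt m j
  ... | inj₁ x | inj₁ y = sa x y
  ... | inj₂ x | inj₂ y = sb x y
  ... | inj₁ _ | inj₂ _ = refl
  ... | inj₂ _ | inj₁ _ = refl

  comb-irrefl : ∀ m n c (a : Fin m → Fin m → Bool) (b : Fin n → Fin n → Bool)
              → (∀ x → a x x ≡ false) → (∀ x → b x x ≡ false)
              → ∀ i → comb m n c a b i i ≡ false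
  comb-irrefl m n c a b ia ib i with splitAt m i
  ... | inj₁ x = ia x
  ... | inj₂ x = ib x

combine : Bool → Graph → Graph → Graph
combine c G H = record
  { size = size G + size H
  ; adj = comb (size G) (size H) c (adj G) (adj H)
  ; adj-sym = comb-sym (size G) (size H) c (adj G) (adj H) (Graph.adj-sym G) (Graph.adj-sym H)
  ; irrefl = comb-irrefl (size G) (size H) c (adj G) (adj H) (irrefl G) (irrefl H)
  }

infixl 6 _∪_
_∪_ : Graph → Graph → Graph
G ∪ H = combine false G H

infixl 5 _⊕_
_⊕_ : Graph → Graph → Graph
G ⊕ H = combine true G H

copies : ℕ → Graph → Graph
copies zero    G = K 0
copies (suc k) G = G ∪ copies k G

IsCograph : Graph → Set
IsCograph G = ¬ Contains G (P 4)

-- Partitionable: there is a partition {A, B} of V (A = vertices with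
-- label true, B = vertices with label false) such that G[A] has no
-- induced P_3 (i.e. is a disjoint union of cliques) and G[B] is
-- triangle-free (no K_3).
Partitionable : Graph → Set
Partitionable G =
  Σ (Fin (size G) → Bool) λ A →
    ¬ ContainsIn G A (P 3) × ¬ ContainsIn G (λ v → not (A v)) (K 3)

H₁ H₂ H₃ H₄ H₅ H₆ H₇ H₈ H₉ H₁₀ H₁₁ H₁₂ H₁₃ H₁₄ H₁₅ H₁₆ H₁₇ : Graph
H₁  = copies 2 (K 1) ⊕ copies 2 (K 1) ⊕ copies 2 (K 1) ⊕ K 1
H₂  = P 3 ⊕ K 1 ⊕ copies 2 (K 2)
H₃  = copies 2 (K 1) ⊕ (K 2 ∪ K 1) ⊕ (K 2 ∪ K 1)
H₄  = P 3 ⊕ (K 2 ∪ P 3)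
H₅  = (K 2 ∪ K 1) ⊕ K 1 ⊕ copies 2 (K 2)
H₆  = (K 2 ∪ K 1) ⊕ (K 3 ∪ P 3)
H₇  = (K 2 ∪ K 1) ⊕ (K 2 ∪ (P 3 ⊕ K 1))
H₈  = (K 2 ∪ K 1) ⊕ (K 2 ∪ (K 1 ⊕ (K 2 ∪ K 1)))
H₉  = K 1 ⊕ (K 3 ∪ (C₄ ⊕ K 1))
H₁₀ = K 1 ⊕ (K 3 ∪ (K 1 ⊕ (P 3 ∪ K 2)))
H₁₁ = K 1 ⊕ (K 3 ∪ (K 2 ⊕ copies 2 (K 2)))
H₁₂ = K 1 ⊕ (K 3 ∪ ((K 2 ∪ K 1) ⊕ (K 2 ∪ K 1)))
H₁₃ = K 2 ⊕ (P 3 ∪ copies 2 (K 3))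
H₁₄ = K 2 ⊕ (K 3 ∪ (P 3 ⊕ K 1))
H₁₅ = K 2 ⊕ (K 3 ∪ (K 1 ⊕ (K 1 ∪ K 2)))
H₁₆ = (K 3 ∪ K 2) ⊕ (K 3 ∪ K 1)
H₁₇ = K 3 ⊕ copies 2 (K 3)

HFree : Graph → Set
HFree G =
  ¬ Contains G H₁  × ¬ Contains G H₂  × ¬ Contains G H₃  × ¬ Contains G H₄  ×
  ¬ Contains G H₅  × ¬ Contains G H₆  × ¬ Contains G H₇  × ¬ Contains G H₈  ×
  ¬ Contains G H₉  × ¬ Contains G H₁₀ × ¬ Contains G H₁₁ × ¬ Contains G H₁₂ ×
  ¬ Contains G H₁₃ × ¬ Contains G H₁₄ × ¬ Contains G H₁₅ × ¬ Contains G H₁₆ ×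
  ¬ Contains G H₁₇

{-# OPTIONS --safe #-}
-- Suppose that every vertex of one part of G is adjacent to all, or to no, vertices of the other
-- part. Then partitions {A, B} of the two parts glue to one of G under a condition that only
-- involves their profiles: whether G[A] is empty, a clique or a disjoint union of cliques, and
-- the clique number of G[B]. Forty small cographs, proper pieces of the Hᵢ, suffice as
-- representatives: every nonempty cograph without an Hᵢ contains a representative and admits all
-- profiles listed for it, one of which is a partition as wanted. Since a P₄-free graph with at
-- least two vertices is a disjoint union or a join, this only requires that the union and the
-- join of two representatives always contain an Hᵢ, or a representative whose profiles arise by
-- gluing; that is a finite computation. Conversely, a partition restricts to induced subgraphs,
-- and backtracking over the labellings shows that no Hᵢ is partitionable.
module Submission where

open import Defs
open import Data.Bool using (Bool; true; false; _∧_; _∨_; not; T; T?; if_then_else_)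
import Data.Bool as Bool
open import Data.Bool.ListAction using (any; all)
open import Data.Bool.Properties
  using (T-∧; T-∨; ¬-not; not-¬; ∧-zeroʳ; ∧-identityʳ; not-injective; not-involutive)
open import Data.Empty using (⊥; ⊥-elim)
open import Data.Fin using (Fin; zero; suc; splitAt; _≟_)
open import Data.Fin.Properties using (all?; splitAt⁻¹-↑ˡ; splitAt⁻¹-↑ʳ)
open import Data.List
  using (List; []; _∷_; allFin; cartesianProductWith; filter; length; map; filterᵇ; concatMap; _++_)
open import Data.List.Membership.DecPropositional using () renaming (_∈?_ to member?)
open import Data.List.Membership.Propositional using (_∈_; find; lose)
open import Data.List.Membership.Propositional.Properties
  using (∈-allFin; ∈-map⁺; ∈-map⁻; ∈-++⁻; ∈-concatMap⁻; ∈-filter⁺; ∈-filter⁻; ∈-cartesianProductWith⁻)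
open import Data.List.Properties using (filter-notAll)
open import Data.List.Relation.Unary.All as All using (All; []; _∷_)
open import Data.List.Relation.Unary.All.Properties using (all⁺)
open import Data.List.Relation.Unary.Any using (any?; here; there)
open import Data.List.Relation.Unary.Any.Properties using (any⁻)
open import Data.Nat using (ℕ; zero; suc; _+_; _⊔_; _≤_; _<_; _≤ᵇ_; z≤n; s≤s)
open import Data.Nat.Induction using (<-wellFounded)
open import Data.Nat.Properties using (≤ᵇ⇒≤; ≤-reflexive; m≤m⊔n; m≤n⊔m; +-suc)
open import Data.Product using (Σ; ∃; _×_; _,_; proj₁; proj₂)
open import Data.Sum using (_⊎_; inj₁; inj₂; [_,_]′)
import Data.Sum as Sum
open import Data.Unit using (tt)
open import Data.Vec using (Vec; []; _∷_; lookup)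
open import Function using (_∘_; id; case_of_)
open import Function.Bundles using (_⇔_; mk⇔; Equivalence)
open import Induction.WellFounded using (Acc; acc)
open import Level using (0ℓ)
open import Relation.Binary.PropositionalEquality using (_≡_; _≢_; refl; sym; trans; cong)
open import Relation.Nullary using (¬_; Dec; yes; no; does; contradiction)
open import Relation.Nullary.Decidable using (from-yes; dec-true; dec-false; _×-dec_; _→-dec_; ¬?)
open import Relation.Unary using (Pred; _⊆_)

-- Cotrees and a search for induced subgraphs between them.

data Cotree : Set where
  ∅ •  : Cotree
  node : Bool → Cotree → Cotree → Cotree

⟦_⟧ : Cotree → Graph
⟦ ∅ ⟧          = K 0
⟦ • ⟧          = K 1
⟦ node c X Y ⟧ = combine c ⟦ X ⟧ ⟦ Y ⟧

-- The empty graph is a unit for union and join; absorbing it keeps nodes with an empty child out of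
-- the trees that are compared.
attach : Bool → Cotree → Cotree → Cotree
attach c ∅            Y = Y
attach c X@(•)        ∅ = X
attach c X@(node _ _ _) ∅ = X
attach c X            Y = node c X Y

attach² : Bool → Cotree × Cotree → Cotree × Cotree → Cotree × Cotree
attach² c (Y₁ , Y₂) (Z₁ , Z₂) = attach c Y₁ Z₁ , attach c Y₂ Z₂

-- The ways to place X into a graph consisting of two parts with all pairs across of adjacency c.
divisions : Bool → Cotree → List (Cotree × Cotree)
divisions c     ∅                = (∅ , ∅) ∷ []
divisions false (node false Y Z) =
  cartesianProductWith (attach² false) (divisions false Y) (divisions false Z)
divisions true  (node true  Y Z) =
  cartesianProductWith (attach² true) (divisions true Y) (divisions true Z)
divisions _     X                = (X , ∅) ∷ (∅ , X) ∷ []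

order : Cotree → ℕ
order ∅            = 0
order •            = 1
order (node _ X Y) = order X + order Y

-- Comparing the orders only prunes the search.
infix 4 _≼_
_≼_ : Cotree → Cotree → Bool
∅ ≼ t          = true
• ≼ •          = true
X ≼ node c s t = (order X ≤ᵇ order s + order t)
  ∧ any (λ d → (proj₁ d ≼ s) ∧ (proj₂ d ≼ t)) (divisions c X)
_ ≼ _          = false

-- Terms for obstructions and representatives.

infixl 8 _∥_
infixl 7 _⋈_

-- A term has two readings: `graph` is the graph as the statement spells it, `tree` a cotree on
-- which `≼` computes. `realise` passes from the second to the first.
data Term : Set where
  κ          : ℕ → Term
  path cycle : Term
  _∥_ _⋈_    : Term → Term → Term

graph : Term → Graph
graph (κ n)   = K n
graph path    = P 3
graph cycle   = C₄
graph (s ∥ t) = graph s ∪ graph t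
graph (s ⋈ t) = graph s ⊕ graph t

complete : ℕ → Cotree
complete zero    = ∅
complete (suc n) = attach true • (complete n)

tree : Term → Cotree
tree (κ n)   = complete n
tree path    = node true • (node false • •)
tree cycle   = node true (node false • •) (node false • •)
tree (s ∥ t) = attach false (tree s) (tree t)
tree (s ⋈ t) = attach true (tree s) (tree t)

-- Mirrors copies 2, including its K 0, so that graph maps the obstructions to H₁, …, H₁₇
-- definitionally.
twice : Term → Term
twice t = t ∥ (t ∥ κ 0)

obstructions : List Term
obstructions
  = (twice (κ 1) ⋈ twice (κ 1) ⋈ twice (κ 1) ⋈ κ 1)
  ∷ (path ⋈ κ 1 ⋈ twice (κ 2))
  ∷ (twice (κ 1) ⋈ (κ 2 ∥ κ 1) ⋈ (κ 2 ∥ κ 1))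
  ∷ (path ⋈ (κ 2 ∥ path))
  ∷ ((κ 2 ∥ κ 1) ⋈ κ 1 ⋈ twice (κ 2))
  ∷ ((κ 2 ∥ κ 1) ⋈ (κ 3 ∥ path))
  ∷ ((κ 2 ∥ κ 1) ⋈ (κ 2 ∥ (path ⋈ κ 1)))
  ∷ ((κ 2 ∥ κ 1) ⋈ (κ 2 ∥ (κ 1 ⋈ (κ 2 ∥ κ 1))))
  ∷ (κ 1 ⋈ (κ 3 ∥ (cycle ⋈ κ 1)))
  ∷ (κ 1 ⋈ (κ 3 ∥ (κ 1 ⋈ (path ∥ κ 2))))
  ∷ (κ 1 ⋈ (κ 3 ∥ (κ 2 ⋈ twice (κ 2))))
  ∷ (κ 1 ⋈ (κ 3 ∥ ((κ 2 ∥ κ 1) ⋈ (κ 2 ∥ κ 1))))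
  ∷ (κ 2 ⋈ (path ∥ twice (κ 3)))
  ∷ (κ 2 ⋈ (κ 3 ∥ (path ⋈ κ 1)))
  ∷ (κ 2 ⋈ (κ 3 ∥ (κ 1 ⋈ (κ 1 ∥ κ 2))))
  ∷ ((κ 3 ∥ κ 2) ⋈ (κ 3 ∥ κ 1))
  ∷ (κ 3 ⋈ twice (κ 3))
  ∷ []

Free : Graph → Set
Free G = All (λ o → ¬ Contains G (graph o)) obstructions

-- Profiles of partitions and their gluing.

data Shape : Set where
  empty clique cluster : Shape

-- Shapes are ordered by implication: the empty set counts as a clique, and a clique as a cluster.
_≤ˢ_ : Shape → Shape → Bool
empty   ≤ˢ _       = true
clique  ≤ˢ clique  = true
_       ≤ˢ cluster = true
_       ≤ˢ _       = false

≤ˢ-cluster : ∀ s → T (s ≤ˢ cluster)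
≤ˢ-cluster empty   = tt
≤ˢ-cluster clique  = tt
≤ˢ-cluster cluster = tt

-- In a join, two nonempty sets form a disjoint union of cliques only if both are cliques, and then
-- they form one clique. In a union they keep the cluster property but are never a single clique.
fitsShape : Bool → Shape → Shape → Shape → Bool
fitsShape c     empty  s      t       = s ≤ˢ t
fitsShape c     s      empty  t       = s ≤ˢ t
fitsShape true  clique clique t       = clique ≤ˢ t
fitsShape false s      s′     cluster = true
fitsShape _     _      _      _       = false

-- Clique numbers add up in a join; in a disjoint union the maximum counts.
fitsClique : Bool → ℕ → ℕ → ℕ → Bool
fitsClique true  k l m = k + l ≤ᵇ m
fitsClique false k l m = k ⊔ l ≤ᵇ m

-- (s , k) stands for the partitions {A , B} with A of shape s and B free of K_{k+1}.
Profile : Set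
Profile = Shape × ℕ

fits : Bool → Profile → Profile → Profile → Bool
fits c (s , k) (s′ , l) (t , m) = fitsShape c s s′ t ∧ fitsClique c k l m

covers : Bool → List Profile → List Profile → Profile → Bool
covers c ps qs r = any (λ p → any (λ q → fits c p q r) qs) ps

-- Representatives and the closure computation.

Class : Set
Class = List Profile × List Term

-- The representatives, grouped by their minimal profiles. A computer found them by closing K₁
-- under union and join, discarding every graph that contains another one all of whose profiles it admits.
classes : List Class
classes
  = ((empty , 1) ∷ (clique , 0) ∷ [] ,
       κ 1 ∷ [])
  ∷ ((empty , 1) ∷ (cluster , 0) ∷ [] ,
       (κ 1 ∥ κ 1) ∷ [])
  ∷ ((empty , 2) ∷ (clique , 0) ∷ [] ,
       κ 2 ∷ [])
  ∷ ((empty , 2) ∷ (clique , 1) ∷ (cluster , 0) ∷ [] ,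
       (κ 1 ∥ κ 2) ∷ [])
  ∷ ((clique , 0) ∷ [] ,
       κ 3 ∷ [])
  ∷ ((empty , 2) ∷ (clique , 1) ∷ [] ,
       path ∷ [])
  ∷ ((clique , 1) ∷ (cluster , 0) ∷ [] ,
       (κ 1 ∥ κ 3) ∷ [])
  ∷ ((empty , 2) ∷ (cluster , 0) ∷ [] ,
       (κ 2 ∥ κ 2) ∷ [])
  ∷ ((clique , 1) ∷ [] ,
       (κ 2 ⋈ (κ 1 ∥ κ 1)) ∷ (κ 1 ⋈ (κ 1 ∥ κ 2)) ∷ [])
  ∷ ((empty , 2) ∷ (cluster , 1) ∷ [] ,
       cycle ∷ (κ 2 ∥ path) ∷ [])
  ∷ ((clique , 2) ∷ (cluster , 0) ∷ [] ,
       (κ 2 ∥ κ 3) ∷ [])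
  ∷ ((clique , 2) ∷ [] ,
       (κ 1 ⋈ (κ 1 ∥ κ 1) ⋈ (κ 1 ∥ κ 1)) ∷ (κ 2 ⋈ (κ 2 ∥ κ 2)) ∷ (κ 1 ⋈ (κ 2 ∥ path)) ∷
       ((κ 1 ∥ κ 2) ⋈ (κ 1 ∥ κ 2)) ∷ [])
  ∷ ((clique , 2) ∷ (cluster , 1) ∷ [] ,
       (κ 1 ⋈ (κ 2 ∥ κ 2)) ∷ ((κ 1 ∥ κ 1) ⋈ (κ 1 ∥ κ 2)) ∷ (κ 2 ∥ (κ 2 ⋈ (κ 1 ∥ κ 1))) ∷
       (κ 2 ∥ (κ 1 ⋈ (κ 1 ∥ κ 2))) ∷ (κ 3 ∥ path) ∷ [])
  ∷ ((cluster , 0) ∷ [] ,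
       (κ 3 ∥ κ 3) ∷ [])
  ∷ ((cluster , 2) ∷ [] ,
       ((κ 1 ∥ κ 1) ⋈ (κ 1 ∥ κ 1) ⋈ (κ 1 ∥ κ 1)) ∷ (κ 1 ⋈ (κ 1 ∥ κ 1) ⋈ (κ 2 ∥ κ 2)) ∷
       ((κ 1 ∥ κ 1) ⋈ (κ 2 ∥ path)) ∷ ((κ 1 ∥ κ 2) ⋈ (κ 2 ∥ κ 2)) ∷
       (κ 3 ∥ (κ 1 ⋈ (κ 1 ∥ κ 1) ⋈ (κ 1 ∥ κ 1))) ∷ (κ 2 ⋈ (κ 3 ∥ κ 3)) ∷
       (κ 1 ⋈ (κ 3 ∥ (κ 2 ⋈ (κ 1 ∥ κ 1)))) ∷ (κ 1 ⋈ (κ 3 ∥ (κ 1 ⋈ (κ 1 ∥ κ 2)))) ∷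
       (κ 3 ∥ (κ 2 ⋈ (κ 2 ∥ κ 2))) ∷ (κ 3 ∥ (κ 1 ⋈ (κ 2 ∥ path))) ∷
       (κ 3 ∥ ((κ 1 ∥ κ 2) ⋈ (κ 1 ∥ κ 2))) ∷ (κ 1 ⋈ (κ 3 ∥ κ 3 ∥ path)) ∷ [])
  ∷ ((cluster , 1) ∷ [] ,
       ((κ 1 ∥ κ 1) ⋈ (κ 2 ∥ κ 2)) ∷ (κ 3 ∥ (κ 2 ⋈ (κ 1 ∥ κ 1))) ∷
       (κ 3 ∥ (κ 1 ⋈ (κ 1 ∥ κ 2))) ∷ (κ 1 ⋈ (κ 3 ∥ κ 3)) ∷ (κ 3 ∥ κ 3 ∥ path) ∷ [])
  ∷ []

coveredClasses : Bool → List Profile → List Profile → List Class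
coveredClasses c ps qs = filterᵇ (λ K → all (covers c ps qs) (proj₁ K)) classes

allReduce : Bool → List Cotree → List Cotree → List Cotree → Bool
allReduce c us ss ts = all (λ s → all (λ t → any (_≼ node c s t) us) ts) ss

-- Inside the glued representatives there must be an obstruction or a representative of a class all
-- of whose profiles arise by gluing; one search runs through both kinds.
reduces : Bool → Class → Class → Bool
reduces c (ps , ss) (qs , ts) =
  allReduce c (map tree (concatMap proj₂ (coveredClasses c ps qs) ++ obstructions))
              (map tree ss) (map tree ts)

-- Each unordered pair of classes is tested in one order; swapping the sides of a bisection gives
-- the other.
closedUnder : Bool → List Class → Bool
closedUnder c []       = true
closedUnder c (K ∷ Ks) = all (reduces c K) (K ∷ Ks) ∧ closedUnder c Ks

-- The finite computation behind the theorem, evaluated by the type checker for unions and for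
-- joins.
closed : ∀ c → T (closedUnder c classes)
closed false = tt
closed true  = tt

∧-split : ∀ {x y} → T (x ∧ y) → T x × T y
∧-split = Equivalence.to T-∧

any-find : ∀ {A : Set} (p : A → Bool) {xs} → T (any p xs) → ∃ λ x → x ∈ xs × T (p x)
any-find p = find ∘ any⁻ p _

closedUnder-sound : ∀ c Ks → T (closedUnder c Ks) → ∀ {K L} → K ∈ Ks → L ∈ Ks →
                    T (reduces c K L) ⊎ T (reduces c L K)
closedUnder-sound c (K ∷ Ks) h (here refl) L∈ =
  inj₁ (All.lookup (all⁺ (reduces c K) (K ∷ Ks) (proj₁ (∧-split h))) L∈)
closedUnder-sound c (K ∷ Ks) h (there K∈) (here refl) =
  inj₂ (All.lookup (all⁺ (reduces c K) (K ∷ Ks) (proj₁ (∧-split h))) (there K∈))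
closedUnder-sound c (K ∷ Ks) h (there K∈) (there L∈) =
  closedUnder-sound c Ks (proj₂ (∧-split h)) K∈ L∈

allReduce-sound : ∀ c us ss ts → T (allReduce c us ss ts) → ∀ {s t} → s ∈ ss → t ∈ ts →
                  ∃ λ u → u ∈ us × T (u ≼ node c s t)
allReduce-sound c us ss ts h {s} {t} s∈ t∈ = any-find (_≼ node c s t) {us}
  (All.lookup (all⁺ (λ t → any (_≼ node c s t) us) ts
    (All.lookup (all⁺ (λ s → all (λ t → any (_≼ node c s t) us) ts) ss h) s∈)) t∈)

-- Induced copies inside vertex sets.

record Copy (G : Graph) (P : Pred (Fin (size G)) 0ℓ) (H : Graph) : Set where
  field
    vertex   : Fin (size H) → Fin (size G)
    inside   : ∀ i → P (vertex i)
    distinct : ∀ {i j} → i ≢ j → vertex i ≢ vertex j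
    faithful : ∀ {i j} → i ≢ j → adj G (vertex i) (vertex j) ≡ adj H i j

-- A decidable check of a renumbering, for graphs whose cotree lists the vertices in another order.
IsCopy : (H H′ : Graph) → Vec (Fin (size H)) (size H′) → Set
IsCopy H H′ π = ∀ i j → i ≢ j →
  lookup π i ≢ lookup π j × adj H (lookup π i) (lookup π j) ≡ adj H′ i j

isCopy? : ∀ H H′ π → Dec (IsCopy H H′ π)
isCopy? H H′ π = all? λ i → all? λ j → ¬? (i ≟ j) →-dec
  (¬? (lookup π i ≟ lookup π j) ×-dec (adj H (lookup π i) (lookup π j) Bool.≟ adj H′ i j))

module _ (G : Graph) where

  private
    V = Fin (size G)

  -- Distinctness is demanded separately: for `c = false` the adjacency condition alone would allow
  -- a common vertex.
  Link : Bool → Pred V 0ℓ → Pred V 0ℓ → Set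
  Link c P Q = ∀ {x y} → P x → Q y → x ≢ y × adj G x y ≡ c

  Link-sym : ∀ {c P Q} → Link c P Q → Link c Q P
  Link-sym l q p = proj₁ (l p q) ∘ sym , trans (adj-sym G _ _) (proj₂ (l p q))

  infixr 5 _∨ᴾ_
  _∨ᴾ_ : Pred V 0ℓ → Pred V 0ℓ → Pred V 0ℓ
  (P ∨ᴾ Q) v = P v ⊎ Q v

  infix 4 _⊑_
  -- An induced copy recorded along the cotree: the children of a node live in two linked sets, and
  -- no numbering of vertices is involved.
  data _⊑_ : Cotree → Pred V 0ℓ → Set₁ where
    empty  : ∀ {P} → ∅ ⊑ P
    single : ∀ {P v} → P v → • ⊑ P
    node   : ∀ {c X Y P Q R} → X ⊑ Q → Y ⊑ R → Link c Q R → Q ⊆ P → R ⊆ P → node c X Y ⊑ P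

  ⊑-mono : ∀ {X P Q} → P ⊆ Q → X ⊑ P → X ⊑ Q
  ⊑-mono P⊆Q empty            = empty
  ⊑-mono P⊆Q (single p)       = single (P⊆Q p)
  ⊑-mono P⊆Q (node x y l i j) = node x y l (P⊆Q ∘ i) (P⊆Q ∘ j)

  -- A child absorbed by `attach` is restored inside the empty set.
  detach : ∀ c X Y {P} → attach c X Y ⊑ P → node c X Y ⊑ P
  detach c ∅            Y            e = node {Q = λ _ → ⊥} empty e (λ ()) (λ ()) id
  detach c •            ∅            e = node {R = λ _ → ⊥} e empty (λ _ ()) id (λ ())
  detach c (node _ _ _) ∅            e = node {R = λ _ → ⊥} e empty (λ _ ()) id (λ ())
  detach c •            •            e = e
  detach c •            (node _ _ _) e = e
  detach c (node _ _ _) •            e = e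
  detach c (node _ _ _) (node _ _ _) e = e

  -- The four pieces are pairwise linked by the same `c`, so they may be paired the other way round.
  regroup : ∀ {c X Y A₁ A₂ B₁ B₂ P Q} →
            (∀ {P Q} → A₁ ⊑ P → B₁ ⊑ Q → Link c P Q → X ⊑ P ∨ᴾ Q) →
            (∀ {P Q} → A₂ ⊑ P → B₂ ⊑ Q → Link c P Q → Y ⊑ P ∨ᴾ Q) →
            node c A₁ A₂ ⊑ P → node c B₁ B₂ ⊑ Q → Link c P Q → node c X Y ⊑ P ∨ᴾ Q
  regroup f g (node a₁ a₂ lᵃ i₁ i₂) (node b₁ b₂ lᵇ j₁ j₂) l =
    node (f a₁ b₁ (λ p q → l (i₁ p) (j₁ q))) (g a₂ b₂ (λ p q → l (i₂ p) (j₂ q)))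
         (λ { (inj₁ p) (inj₁ q) → lᵃ p q
            ; (inj₁ p) (inj₂ q) → l (i₁ p) (j₂ q)
            ; (inj₂ p) (inj₁ q) → Link-sym l (j₁ p) (i₂ q)
            ; (inj₂ p) (inj₂ q) → lᵇ p q })
         (Sum.map i₁ j₁) (Sum.map i₂ j₂)

  undivided : ∀ {X A B P Q} → (A , B) ∈ (X , ∅) ∷ (∅ , X) ∷ [] → A ⊑ P → B ⊑ Q → X ⊑ P ∨ᴾ Q
  undivided (here refl)         a b = ⊑-mono inj₁ a
  undivided (there (here refl)) a b = ⊑-mono inj₂ b

  -- At a node labelled `c` both children are divided and reunited separately, then regrouped; any
  -- other nonempty tree lies on one side as a whole.
  reunite : ∀ c X {A B P Q} → (A , B) ∈ divisions c X →
            A ⊑ P → B ⊑ Q → Link c P Q → X ⊑ P ∨ᴾ Q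
  reunite c     ∅               m a b l = empty
  reunite false •               m a b l = undivided m a b
  reunite true  •               m a b l = undivided m a b
  reunite false (node true Y Z) m a b l = undivided m a b
  reunite true (node false Y Z) m a b l = undivided m a b
  reunite false (node false Y Z) m a b l
    with (Y₁ , Y₂) , (Z₁ , Z₂) , y , z , refl
           ← ∈-cartesianProductWith⁻ (attach² false) (divisions false Y) (divisions false Z) m
    = regroup (reunite false Y y) (reunite false Z z) (detach _ Y₁ Z₁ a) (detach _ Y₂ Z₂ b) l
  reunite true (node true Y Z) m a b l
    with (Y₁ , Y₂) , (Z₁ , Z₂) , y , z , refl
           ← ∈-cartesianProductWith⁻ (attach² true) (divisions true Y) (divisions true Z) m
    = regroup (reunite true Y y) (reunite true Z z) (detach _ Y₁ Z₁ a) (detach _ Y₂ Z₂ b) l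

  mutual
    ≼-sound : ∀ X t {P} → T (X ≼ t) → t ⊑ P → X ⊑ P
    ≼-sound ∅              t            h e = empty
    ≼-sound •              •            h e = e
    ≼-sound •              (node c s t) h e = ≼-sound-node • (proj₂ (∧-split h)) e
    ≼-sound X@(node _ _ _) (node c s t) h e = ≼-sound-node X (proj₂ (∧-split {order X ≤ᵇ _} h)) e

    -- The search yields a division of `X` whose halves fit into the two children; `reunite`
    -- reassembles them.
    ≼-sound-node : ∀ X {c s t P} → T (any (λ d → (proj₁ d ≼ s) ∧ (proj₂ d ≼ t)) (divisions c X)) →
                   node c s t ⊑ P → X ⊑ P
    ≼-sound-node X {c} {s} {t} h (node e f l i j)
      with (A , B) , m , h′ ← any-find (λ d → (proj₁ d ≼ s) ∧ (proj₂ d ≼ t)) {divisions c X} h =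
      let a , b = ∧-split h′ in
      ⊑-mono [ i , j ]′ (reunite c X m (≼-sound A s a e) (≼-sound B t b f) l)

  Copy-mono : ∀ {H P Q} → P ⊆ Q → Copy G P H → Copy G Q H
  Copy-mono P⊆Q f = record
    { vertex = vertex ; inside = λ i → P⊆Q (inside i) ; distinct = distinct ; faithful = faithful }
    where open Copy f

  Copy-combine : ∀ {c P Q H H′} → Link c P Q → Copy G P H → Copy G Q H′ →
                 Copy G (P ∨ᴾ Q) (combine c H H′)
  Copy-combine {c} {P} {Q} {H} {H′} l f g = record
    { vertex = λ i → [ F.vertex , G′.vertex ]′ (splitAt (size H) i)
    ; inside = ins ; distinct = λ ne → proj₁ (pair _ _ ne) ; faithful = λ ne → proj₂ (pair _ _ ne) }
    where
    module F = Copy f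
    module G′ = Copy g

    ins : ∀ i → (P ∨ᴾ Q) ([ F.vertex , G′.vertex ]′ (splitAt (size H) i))
    ins i with splitAt (size H) i
    ... | inj₁ x = inj₁ (F.inside x)
    ... | inj₂ y = inj₂ (G′.inside y)

    pair : ∀ i j → i ≢ j →
           let u = [ F.vertex , G′.vertex ]′ (splitAt (size H) i)
               v = [ F.vertex , G′.vertex ]′ (splitAt (size H) j)
           in u ≢ v × adj G u v ≡ adj (combine c H H′) i j
    pair i j i≢j with splitAt (size H) i in p | splitAt (size H) j in q
    ... | inj₁ x | inj₂ y = l (F.inside x) (G′.inside y)
    ... | inj₂ x | inj₁ y = Link-sym l (G′.inside x) (F.inside y)
    ... | inj₁ x | inj₁ y = F.distinct x≢y , F.faithful x≢y
      where
      x≢y : x ≢ y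
      x≢y refl = i≢j (trans (sym (splitAt⁻¹-↑ˡ p)) (splitAt⁻¹-↑ˡ q))
    ... | inj₂ x | inj₂ y = G′.distinct x≢y , G′.faithful x≢y
      where
      x≢y : x ≢ y
      x≢y refl = i≢j (trans (sym (splitAt⁻¹-↑ʳ p)) (splitAt⁻¹-↑ʳ q))

  Copy-trans : ∀ {P} H H′ π → IsCopy H H′ π → Copy G P H → Copy G P H′
  Copy-trans H H′ π c f = record
    { vertex   = vertex ∘ lookup π
    ; inside   = inside ∘ lookup π
    ; distinct = λ i≢j → distinct (proj₁ (c _ _ i≢j))
    ; faithful = λ i≢j → trans (faithful (proj₁ (c _ _ i≢j))) (proj₂ (c _ _ i≢j)) }
    where open Copy f

  -- A `Copy` speaks of distinct indices only; decidable equality and looplessness supply the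
  -- diagonal.
  Copy⇒ContainsIn : ∀ A {H} → Copy G (λ v → A v ≡ true) H → ContainsIn G A H
  Copy⇒ContainsIn A {H} f = vertex , injective , inside , preserves
    where
    open Copy f

    injective : ∀ {i j} → vertex i ≡ vertex j → i ≡ j
    injective {i} {j} eq with i ≟ j
    ... | yes i≡j = i≡j
    ... | no i≢j  = contradiction eq (distinct i≢j)

    preserves : ∀ i j → adj H i j ≡ adj G (vertex i) (vertex j)
    preserves i j with i ≟ j
    ... | yes refl = trans (irrefl H i) (sym (irrefl G (vertex i)))
    ... | no i≢j   = sym (faithful i≢j)

  ⊑⇒Copy : ∀ {X P} → X ⊑ P → Copy G P ⟦ X ⟧
  ⊑⇒Copy empty = record
    { vertex = λ () ; inside = λ () ; distinct = λ { {()} } ; faithful = λ { {()} } }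
  ⊑⇒Copy (single {v = v} p) = record
    { vertex   = λ _ → v
    ; inside   = λ _ → p
    ; distinct = λ { {zero} {zero} 0≢0 → contradiction refl 0≢0 }
    ; faithful = λ { {zero} {zero} 0≢0 → contradiction refl 0≢0 } }
  ⊑⇒Copy (node e f l i j) = Copy-mono [ i , j ]′ (Copy-combine l (⊑⇒Copy e) (⊑⇒Copy f))

  -- `K n` is not literally an iterated join, so the copy is built vertex by vertex.
  complete-⊑⇒Copy : ∀ n {P} → complete n ⊑ P → Copy G P (K n)
  complete-⊑⇒Copy zero    e = ⊑⇒Copy empty
  complete-⊑⇒Copy (suc n) {P} e with detach true • (complete n) e
  ... | node (single {v = v} p) f l i j = record
    { vertex   = vertex′
    ; inside   = inside′
    ; distinct = λ {a} {b} → distinct′ {a} {b}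
    ; faithful = λ {a} {b} → faithful′ {a} {b} }
    where
    open Copy (complete-⊑⇒Copy n f)

    vertex′ : Fin (suc n) → V
    vertex′ zero    = v
    vertex′ (suc a) = vertex a

    inside′ : ∀ a → P (vertex′ a)
    inside′ zero    = i p
    inside′ (suc a) = j (inside a)

    distinct′ : ∀ {a b} → a ≢ b → vertex′ a ≢ vertex′ b
    distinct′ {zero}  {zero}  ne = contradiction refl ne
    distinct′ {zero}  {suc b} ne = proj₁ (l p (inside b))
    distinct′ {suc a} {zero}  ne = proj₁ (l p (inside a)) ∘ sym
    distinct′ {suc a} {suc b} ne = distinct (ne ∘ cong suc)

    faithful′ : ∀ {a b} → a ≢ b → adj G (vertex′ a) (vertex′ b) ≡ adj (K (suc n)) a b
    faithful′ {zero}  {zero}  ne = contradiction refl ne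
    faithful′ {zero}  {suc b} ne = proj₂ (l p (inside b))
    faithful′ {suc a} {zero}  ne = trans (adj-sym G _ _) (proj₂ (l p (inside a)))
    faithful′ {suc a} {suc b} ne = faithful (ne ∘ cong suc)

  realise : ∀ t {P} → tree t ⊑ P → Copy G P (graph t)
  realise (κ n) e = complete-⊑⇒Copy n e
  realise path  e = Copy-trans ⟦ tree path ⟧ (P 3) π (from-yes (isCopy? ⟦ tree path ⟧ (P 3) π)) (⊑⇒Copy e)
    -- The cotree lists the centre of the path first.
    where π = suc zero ∷ zero ∷ suc (suc zero) ∷ []
  realise cycle e = Copy-trans ⟦ tree cycle ⟧ C₄ π (from-yes (isCopy? ⟦ tree cycle ⟧ C₄ π)) (⊑⇒Copy e)
    -- Opposite vertices of the cycle form the two independent pairs of the cotree.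
    where π = zero ∷ suc (suc zero) ∷ suc zero ∷ suc (suc (suc zero)) ∷ []
  realise (s ∥ t) e with detach false (tree s) (tree t) e
  ... | node f g l i j = Copy-mono [ i , j ]′ (Copy-combine l (realise s f) (realise t g))
  realise (s ⋈ t) e with detach true (tree s) (tree t) e
  ... | node f g l i j = Copy-mono [ i , j ]′ (Copy-combine l (realise s f) (realise t g))

  -- Shapes and clique numbers under gluing.

  HasShape : Shape → Pred V 0ℓ → Set
  HasShape empty   P = ∀ {x} → ¬ P x
  HasShape clique  P = ∀ {x y} → P x → P y → x ≢ y → adj G x y ≡ true
  -- Cliques without edges between them: adjacency is transitive, apart from walks that return to
  -- their start.
  HasShape cluster P = ∀ {x y z} → P x → P y → P z → x ≢ z →
                       adj G x y ≡ true → adj G y z ≡ true → adj G x z ≡ true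

  HasShape-⊆ : ∀ s {P Q} → P ⊆ Q → HasShape s Q → HasShape s P
  HasShape-⊆ empty   i h p     = h (i p)
  HasShape-⊆ clique  i h p q   = h (i p) (i q)
  HasShape-⊆ cluster i h p q r = h (i p) (i q) (i r)

  HasShape-mono : ∀ s t {P} → T (s ≤ˢ t) → HasShape s P → HasShape t P
  HasShape-mono empty   empty   _ h = h
  HasShape-mono empty   clique  _ h p = contradiction p h
  HasShape-mono empty   cluster _ h p = contradiction p h
  HasShape-mono clique  clique  _ h = h
  HasShape-mono clique  cluster _ h p _ r x≢z _ _ = h p r x≢z
  HasShape-mono cluster cluster _ h = h

  -- Clique number at most `k`, by recursion through neighbourhoods; triangle-free is
  -- `CliqueFree 2`.
  CliqueFree : ℕ → Pred V 0ℓ → Set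
  CliqueFree zero    P = ∀ v → ¬ P v
  CliqueFree (suc k) P = ∀ v → P v → CliqueFree k (λ w → P w × adj G v w ≡ true)

  CliqueFree-⊆ : ∀ k {P Q} → P ⊆ Q → CliqueFree k Q → CliqueFree k P
  CliqueFree-⊆ zero    i h v p = h v (i p)
  CliqueFree-⊆ (suc k) i h v p = CliqueFree-⊆ k (λ (q , a) → i q , a) (h v (i p))

  CliqueFree-mono : ∀ {k l P} → k ≤ l → CliqueFree k P → CliqueFree l P
  CliqueFree-mono {l = zero}  z≤n       h v p = h v p
  CliqueFree-mono {l = suc l} z≤n       h v p = contradiction p (h v)
  CliqueFree-mono             (s≤s k≤l) h v p = CliqueFree-mono k≤l (h v p)

  linked-edge : ∀ {P Q x y} → Link false P Q → P x → Q y → adj G x y ≢ true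
  linked-edge l p q a = case trans (sym a) (proj₂ (l p q)) of λ ()

  cluster-union : ∀ {P Q} → Link false P Q → HasShape cluster P → HasShape cluster Q →
                  HasShape cluster (P ∨ᴾ Q)
  cluster-union l f g (inj₁ p) (inj₁ q) (inj₁ r) x≢z a b = f p q r x≢z a b
  cluster-union l f g (inj₂ p) (inj₂ q) (inj₂ r) x≢z a b = g p q r x≢z a b
  cluster-union l f g (inj₁ p) (inj₂ q) r        x≢z a b = contradiction a (linked-edge l p q)
  cluster-union l f g (inj₂ p) (inj₁ q) r        x≢z a b = contradiction a (linked-edge (Link-sym l) p q)
  cluster-union l f g (inj₁ p) (inj₁ q) (inj₂ r) x≢z a b = contradiction b (linked-edge l q r)
  cluster-union l f g (inj₂ p) (inj₂ q) (inj₁ r) x≢z a b = contradiction b (linked-edge (Link-sym l) q r)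

  clique-join : ∀ {P Q} → Link true P Q → HasShape clique P → HasShape clique Q →
                HasShape clique (P ∨ᴾ Q)
  clique-join l f g (inj₁ p) (inj₁ q) x≢y = f p q x≢y
  clique-join l f g (inj₂ p) (inj₂ q) x≢y = g p q x≢y
  clique-join l f g (inj₁ p) (inj₂ q) x≢y = proj₂ (l p q)
  clique-join l f g (inj₂ p) (inj₁ q) x≢y = proj₂ (Link-sym l p q)

  fitsShape-sound : ∀ c s s′ t {P Q} → T (fitsShape c s s′ t) → Link c P Q →
                    HasShape s P → HasShape s′ Q → HasShape t (P ∨ᴾ Q)
  fitsShape-sound c empty s′ t h l f g =
    HasShape-⊆ t [ ⊥-elim ∘ f , id ]′ (HasShape-mono s′ t h g)
  fitsShape-sound c clique empty t h l f g =
    HasShape-⊆ t [ id , ⊥-elim ∘ g ]′ (HasShape-mono clique t h f)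
  fitsShape-sound c cluster empty t h l f g =
    HasShape-⊆ t [ id , ⊥-elim ∘ g ]′ (HasShape-mono cluster t h f)
  fitsShape-sound true clique clique t h l f g =
    HasShape-mono clique t h (clique-join l f g)
  fitsShape-sound false clique clique cluster h l f g =
    cluster-union l (HasShape-mono clique cluster tt f) (HasShape-mono clique cluster tt g)
  fitsShape-sound false clique cluster cluster h l f g =
    cluster-union l (HasShape-mono clique cluster tt f) g
  fitsShape-sound false cluster clique cluster h l f g =
    cluster-union l f (HasShape-mono clique cluster tt g)
  fitsShape-sound false cluster cluster cluster h l f g = cluster-union l f g

  -- Passing to the neighbourhood of a vertex lowers the bound of the side it lies on, while the
  -- other side merely shrinks.
  CliqueFree-∨ : ∀ k l {P Q} → CliqueFree k P → CliqueFree l Q → CliqueFree (k + l) (P ∨ᴾ Q)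
  CliqueFree-∨ zero    l       f g = CliqueFree-⊆ l [ ⊥-elim ∘ f _ , id ]′ g
  CliqueFree-∨ (suc k) zero    f g v (inj₂ q) = contradiction q (g v)
  CliqueFree-∨ (suc k) l       f g v (inj₁ p) =
    CliqueFree-⊆ (k + l) (λ { (inj₁ q , a) → inj₁ (q , a) ; (inj₂ r , a) → inj₂ r })
                 (CliqueFree-∨ k l (f v p) g)
  CliqueFree-∨ (suc k) (suc l) f g v (inj₂ q) =
    CliqueFree-mono (≤-reflexive (sym (+-suc k l)))
      (CliqueFree-⊆ (suc k + l) (λ { (inj₁ r , a) → inj₁ r ; (inj₂ r , a) → inj₂ (r , a) })
                    (CliqueFree-∨ (suc k) l f (g v q)))

  -- No edge crosses, so a clique stays on one side; both bounds are first raised to their maximum.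
  CliqueFree-⊔ : ∀ k l {P Q} → Link false P Q → CliqueFree k P → CliqueFree l Q →
                 CliqueFree (k ⊔ l) (P ∨ᴾ Q)
  CliqueFree-⊔ k l {P} {Q} link f g =
    union (k ⊔ l) (CliqueFree-mono (m≤m⊔n k l) f) (CliqueFree-mono (m≤n⊔m k l) g)
    where
    union : ∀ m → CliqueFree m P → CliqueFree m Q → CliqueFree m (P ∨ᴾ Q)
    union zero    f g v        = [ f v , g v ]′
    union (suc m) f g v (inj₁ p) =
      CliqueFree-⊆ m (λ { (inj₁ q , a) → q , a
                        ; (inj₂ q , a) → ⊥-elim (linked-edge link p q a) }) (f v p)
    union (suc m) f g v (inj₂ p) =
      CliqueFree-⊆ m (λ { (inj₂ q , a) → q , a
                        ; (inj₁ q , a) → ⊥-elim (linked-edge (Link-sym link) p q a) }) (g v p)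

  fitsClique-sound : ∀ c k l m {P Q} → T (fitsClique c k l m) → Link c P Q →
                     CliqueFree k P → CliqueFree l Q → CliqueFree m (P ∨ᴾ Q)
  fitsClique-sound true  k l m h link f g = CliqueFree-mono (≤ᵇ⇒≤ _ _ h) (CliqueFree-∨ k l f g)
  fitsClique-sound false k l m h link f g = CliqueFree-mono (≤ᵇ⇒≤ _ _ h) (CliqueFree-⊔ k l link f g)

  -- Gluing partitions along a bisection.

  Admits : Pred V 0ℓ → Profile → Set
  Admits P (s , k) = Σ (V → Bool) λ A →
    HasShape s (λ v → P v × A v ≡ true) × CliqueFree k (λ v → P v × A v ≡ false)

  -- The Boolean `side` makes it possible to glue labellings of the two parts into one function.
  record Bisection (c : Bool) (P Q R : Pred V 0ℓ) : Set where
    field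
      side  : V → Bool
      left  : ∀ {v} → P v → side v ≡ true → Q v
      right : ∀ {v} → P v → side v ≡ false → R v
      Q⊆P   : Q ⊆ P
      R⊆P   : R ⊆ P
      link  : Link c Q R

  Bisection-sym : ∀ {c P Q R} → Bisection c P Q R → Bisection c P R Q
  Bisection-sym B = record
    { side  = not ∘ side
    ; left  = λ p e → right p (not-injective e)
    ; right = λ p e → left p (not-injective e)
    ; Q⊆P   = R⊆P
    ; R⊆P   = Q⊆P
    ; link  = Link-sym link }
    where open Bisection B

  fits-sound : ∀ {c P Q R} p q r → T (fits c p q r) → Bisection c P Q R →
               Admits Q p → Admits R q → Admits P r
  fits-sound {c} {P} {Q} {R} (s , k) (s′ , l) (t , m) h B (A₁ , f₁ , g₁) (A₂ , f₂ , g₂) =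
    A , HasShape-⊆ t restrict (fitsShape-sound c s s′ t (proj₁ (∧-split h)) link′ f₁ f₂)
      , CliqueFree-⊆ m restrict
          (fitsClique-sound c k l m (proj₂ (∧-split {fitsShape c s s′ t} h)) link′ g₁ g₂)
    where
    open Bisection B

    A : V → Bool
    A v = if side v then A₁ v else A₂ v

    restrict : ∀ {b v} → P v × A v ≡ b → (Q v × A₁ v ≡ b) ⊎ (R v × A₂ v ≡ b)
    restrict {v = v} (p , a) with side v in eq
    ... | true  = inj₁ (left p eq , a)
    ... | false = inj₂ (right p eq , a)

    link′ : ∀ {b} → Link c (λ v → Q v × A₁ v ≡ b) (λ v → R v × A₂ v ≡ b)
    link′ (q , _) (r , _) = link q r

  covers-sound : ∀ {c P Q R} ps qs r → T (covers c ps qs r) → Bisection c P Q R →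
                 All (Admits Q) ps → All (Admits R) qs → Admits P r
  covers-sound {c} ps qs r h B aQ aR
    with p , p∈ , h₁ ← any-find (λ p → any (λ q → fits c p q r) qs) {ps} h
    with q , q∈ , h₂ ← any-find (λ q → fits c p q r) {qs} h₁
    = fits-sound p q r h₂ B (All.lookup aQ p∈) (All.lookup aR q∈)

  ContainsIn⇒Contains : ∀ A H → ContainsIn G A H → Contains G H
  ContainsIn⇒Contains A H (f , injective , _ , preserves) = f , injective , preserves

  -- The invariant of the induction over bisections.
  Represented : Pred V 0ℓ → Set₁
  Represented P = Σ Class λ K → K ∈ classes ×
    Σ Term λ t → t ∈ proj₂ K × tree t ⊑ P × All (Admits P) (proj₁ K)

  module _ (free : Free G) where

    combineRepresented : ∀ {c P Q R} K L {s t} → T (reduces c K L) → Bisection c P Q R →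
      s ∈ proj₂ K → tree s ⊑ Q → All (Admits Q) (proj₁ K) →
      t ∈ proj₂ L → tree t ⊑ R → All (Admits R) (proj₁ L) → Represented P
    combineRepresented {c} (ps , ss) (qs , ts) {s} {t} h B s∈ e aQ t∈ f aR
      with u , u∈ , u≼ ← allReduce-sound c _ (map tree ss) (map tree ts) h (∈-map⁺ tree s∈) (∈-map⁺ tree t∈)
      with o , o∈ , refl ← ∈-map⁻ tree u∈
      with copy ← ≼-sound (tree o) (node c (tree s) (tree t)) u≼
                    (node e f (Bisection.link B) (Bisection.Q⊆P B) (Bisection.R⊆P B))
      with ∈-++⁻ (concatMap proj₂ (coveredClasses c ps qs)) o∈
    -- The tree found is an obstruction, which `free` excludes.
    ... | inj₂ o∈ = contradiction
      (ContainsIn⇒Contains (λ _ → true) (graph o)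
        (Copy⇒ContainsIn (λ _ → true) (Copy-mono (λ _ → refl) (realise o copy))))
      (All.lookup free o∈)
    -- It is a representative of a covered class, so each of its profiles arises by gluing.
    ... | inj₁ o∈
      with K , K∈ , o∈K ← find (∈-concatMap⁻ proj₂ {xs = coveredClasses c ps qs} o∈)
      with K∈ , covered ← ∈-filter⁻ (T? ∘ λ K → all (covers c ps qs) (proj₁ K)) {xs = classes} K∈
      = K , K∈ , o , o∈K , copy
      , All.map (λ h → covers-sound ps qs _ h B aQ aR) (all⁺ (covers c ps qs) (proj₁ K) covered)

    represented-bisection : ∀ {c P Q R} → Bisection c P Q R → Represented Q → Represented R → Represented P
    represented-bisection {c} B (K , K∈ , s , s∈ , e , aQ) (L , L∈ , t , t∈ , f , aR)
      with closedUnder-sound c classes (closed c) K∈ L∈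
    ... | inj₁ h = combineRepresented K L h B s∈ e aQ t∈ f aR
    ... | inj₂ h = combineRepresented L K h (Bisection-sym B) t∈ f aR s∈ e aQ

  -- Splitting a cograph into a union or a join.

  -- All vertices of P 4 have different neighbourhoods, so preserving adjacency forces injectivity.
  P₄-pointDetermining : ∀ i j → (∀ k → adj (P 4) i k ≡ adj (P 4) j k) → i ≡ j
  P₄-pointDetermining = from-yes (all? λ i → all? λ j →
    (all? λ k → adj (P 4) i k Bool.≟ adj (P 4) j k) →-dec (i ≟ j))

  path⇒P₄ : ∀ {a b c d} → adj G a b ≡ true → adj G b c ≡ true → adj G c d ≡ true →
            adj G a c ≡ false → adj G a d ≡ false → adj G b d ≡ false → Contains G (P 4)
  path⇒P₄ {a} {b} {c} {d} ab bc cd ac ad bd = f , injective , λ i j → sym (preserves i j)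
    where
    f : Fin 4 → V
    f = lookup (a ∷ b ∷ c ∷ d ∷ [])

    pattern 0F = zero
    pattern 1F = suc zero
    pattern 2F = suc (suc zero)
    pattern 3F = suc (suc (suc zero))

    preserves : ∀ i j → adj G (f i) (f j) ≡ adj (P 4) i j
    preserves 0F 1F = ab
    preserves 1F 2F = bc
    preserves 2F 3F = cd
    preserves 0F 2F = ac
    preserves 0F 3F = ad
    preserves 1F 3F = bd
    preserves 1F 0F = trans (adj-sym G b a) ab
    preserves 2F 1F = trans (adj-sym G c b) bc
    preserves 3F 2F = trans (adj-sym G d c) cd
    preserves 2F 0F = trans (adj-sym G c a) ac
    preserves 3F 0F = trans (adj-sym G d a) ad
    preserves 3F 1F = trans (adj-sym G d b) bd
    preserves 0F 0F = irrefl G a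
    preserves 1F 1F = irrefl G b
    preserves 2F 2F = irrefl G c
    preserves 3F 3F = irrefl G d

    injective : ∀ {i j} → f i ≡ f j → i ≡ j
    injective {i} {j} eq = P₄-pointDetermining i j λ k →
      trans (sym (preserves i k)) (trans (cong (λ v → adj G v (f k)) eq) (preserves j k))

  -- The complement of the path a - b - c - d is the path b - d - a - c.
  path⇒P₄± : ∀ e {a b c d} → adj G a b ≡ e → adj G b c ≡ e → adj G c d ≡ e →
             adj G a c ≡ not e → adj G a d ≡ not e → adj G b d ≡ not e → Contains G (P 4)
  path⇒P₄± true  ab bc cd ac ad bd = path⇒P₄ ab bc cd ac ad bd
  path⇒P₄± false ab bc cd ac ad bd =
    path⇒P₄ bd (trans (adj-sym G _ _) ad) ac (trans (adj-sym G _ _) ab) bc (trans (adj-sym G _ _) cd)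

  -- `value` tells union from join. Both sides are nonempty, which makes the later recursion
  -- decrease.
  record Split (xs : List V) : Set where
    field
      side   : V → Bool
      value  : Bool
      left   : ∃ λ v → v ∈ xs × side v ≡ true
      right  : ∃ λ v → v ∈ xs × side v ≡ false
      across : ∀ {x y} → x ∈ xs → y ∈ xs → side x ≡ true → side y ≡ false → adj G x y ≡ value

  Split-sym : ∀ {xs} → Split xs → Split xs
  Split-sym S = record
    { side   = not ∘ side
    ; value  = value
    ; left   = let v , v∈ , e = right in v , v∈ , cong not e
    ; right  = let v , v∈ , e = left in v , v∈ , cong not e
    ; across = λ x∈ y∈ p q →
        trans (adj-sym G _ _) (across y∈ x∈ (not-injective q) (not-injective p)) }
    where open Split S

  ∈-∉⇒≢ : ∀ {v w : V} {xs} → w ∈ xs → ¬ v ∈ xs → w ≢ v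
  ∈-∉⇒≢ w∈ v∉ refl = v∉ w∈

  isolate : ∀ {v xs} c → (∃ λ w → w ∈ xs) → ¬ v ∈ xs → (∀ {w} → w ∈ xs → adj G v w ≡ c) → Split (v ∷ xs)
  isolate {v} {xs} c (w , w∈) v∉ h = record
    { side   = λ x → does (x ≟ v)
    ; value  = c
    ; left   = v , here refl , dec-true (v ≟ v) refl
    ; right  = w , there w∈ , dec-false (w ≟ v) (∈-∉⇒≢ w∈ v∉)
    ; across = across }
    where
    across : ∀ {x y} → x ∈ v ∷ xs → y ∈ v ∷ xs → does (x ≟ v) ≡ true → does (y ≟ v) ≡ false → adj G x y ≡ c
    across {x} {y} x∈ y∈ p q with x ≟ v | y ≟ v | y∈
    ... | yes refl | no y≢v | here y≡v = contradiction y≡v y≢v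
    ... | yes refl | no y≢v | there y∈xs = h y∈xs

  -- The vertex `v` moves to the right; the second conjunct of `side′` overrides the label `side`
  -- happens to give it.
  addRight : ∀ {v xs} (S : Split xs) → ¬ v ∈ xs →
             (∀ {w} → w ∈ xs → Split.side S w ≡ true → adj G v w ≡ Split.value S) → Split (v ∷ xs)
  addRight {v} {xs} S v∉ h = record
    { side   = side′
    ; value  = value
    ; left   = let w , w∈ , e = left in
               w , there w∈ , trans (cong (_∧ not (does (w ≟ v))) e)
                                     (cong not (dec-false (w ≟ v) (∈-∉⇒≢ w∈ v∉)))
    ; right  = v , here refl , trans (cong (λ b → side v ∧ not b) (dec-true (v ≟ v) refl))
                                     (∧-zeroʳ (side v))
    ; across = across′ }
    where
    open Split S

    side′ : V → Bool
    side′ w = side w ∧ not (does (w ≟ v))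

    across′ : ∀ {x y} → x ∈ v ∷ xs → y ∈ v ∷ xs → side′ x ≡ true → side′ y ≡ false → adj G x y ≡ value
    across′ {x} {y} x∈ y∈ p q with side x in sx | x ≟ v | x∈
    ... | true | no x≢v | here x≡v = contradiction x≡v x≢v
    ... | true | no x≢v | there x∈xs with y∈ | y ≟ v
    ...   | _          | yes refl = trans (adj-sym G _ _) (h x∈xs sx)
    ...   | here y≡v   | no y≢v   = contradiction y≡v y≢v
    ...   | there y∈xs | no y≢v   = across x∈xs y∈xs sx (trans (sym (∧-identityʳ (side y))) q)

  module _ (cograph : IsCograph G) where

    -- If v has an e-neighbour on both sides, where e = not value, then an e-edge a - b
    -- with a but not b an e-neighbour of v extends to an e-path b - a - v - y.
    extend : ∀ {v xs} → ¬ v ∈ xs → Split xs → Split (v ∷ xs)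
    extend {v} {xs} v∉ S
      with any? (λ w → (side w Bool.≟ true) ×-dec (adj G v w Bool.≟ not value)) xs
         | any? (λ w → (side w Bool.≟ false) ×-dec (adj G v w Bool.≟ not value)) xs
      where open Split S
    ... | no ¬l | _ = addRight S v∉ λ w∈ e →
      trans (¬-not λ f → ¬l (lose w∈ (e , f))) (not-involutive _)
    ... | yes _ | no ¬r = addRight (Split-sym S) v∉ λ w∈ e →
      trans (¬-not λ f → ¬r (lose w∈ (not-injective e , f))) (not-involutive _)
    ... | yes l | yes r
      with any? (λ a → (adj G v a Bool.≟ not value) ×-dec
             any? (λ b → (adj G v b Bool.≟ value) ×-dec (adj G a b Bool.≟ not value)) xs) xs
         | any? (λ b → adj G v b Bool.≟ value) xs
      where open Split S
    ...   | yes h | _ = contradiction P₄ cograph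
      where
      open Split S

      P₄ : Contains G (P 4)
      P₄ with a , a∈ , va , h′ ← find h
         with b , b∈ , vb , ab ← find h′
         with side a in sa | side b in sb
      -- Pairs across the split have adjacency `value`, so `a` and `b` share a side; `y` is taken
      -- from the other.
      ... | true | false = contradiction ab (not-¬ (across a∈ b∈ sa sb))
      ... | false | true = contradiction ab (not-¬ (trans (adj-sym G _ _) (across b∈ a∈ sb sa)))
      ... | true | true with y , y∈ , sy , vy ← find r =
        path⇒P₄± (not value) (trans (adj-sym G _ _) ab) (trans (adj-sym G _ _) va) vy
          (trans (adj-sym G _ _) (trans vb (sym (not-involutive _))))
          (trans (across b∈ y∈ sb sy) (sym (not-involutive _)))
          (trans (across a∈ y∈ sa sy) (sym (not-involutive _)))
      ... | false | false with y , y∈ , sy , vy ← find l =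
        path⇒P₄± (not value) (trans (adj-sym G _ _) ab) (trans (adj-sym G _ _) va) vy
          (trans (adj-sym G _ _) (trans vb (sym (not-involutive _))))
          (trans (adj-sym G _ _) (trans (across y∈ b∈ sy sb) (sym (not-involutive _))))
          (trans (adj-sym G _ _) (trans (across y∈ a∈ sy sa) (sym (not-involutive _))))
    -- Every vertex is a `not value`-neighbour of `v`, so `v` alone forms a side, with the opposite
    -- connective.
    ...   | no _  | no ¬b = isolate (not value) (let w , w∈ , _ = left in w , w∈) v∉ λ w∈ →
      ¬-not λ e → ¬b (lose w∈ e)
      where open Split S
    -- One side becomes `v` with its `not value`-neighbours: by `¬h` no pair of adjacency
    -- `not value` leaves this set, and `hb` makes the other side nonempty.
    ...   | no ¬h | yes hb = record
      { side   = side′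
      ; value  = value
      ; left   = v , here refl , cong (_∨ neighbour v) (dec-true (v ≟ v) refl)
      ; right  = let b , b∈ , vb = find hb in
                 b , there b∈ , trans (cong (_∨ neighbour b) (dec-false (b ≟ v) (∈-∉⇒≢ b∈ v∉)))
                                      (dec-false (adj G v b Bool.≟ not value) (not-¬ vb))
      ; across = across′ }
      where
      open Split S

      neighbour side′ : V → Bool
      neighbour w = does (adj G v w Bool.≟ not value)
      side′ w     = does (w ≟ v) ∨ neighbour w

      across′ : ∀ {x y} → x ∈ v ∷ xs → y ∈ v ∷ xs → side′ x ≡ true → side′ y ≡ false → adj G x y ≡ value
      across′ {x} {y} x∈ y∈ p q with y ≟ v | adj G v y Bool.≟ not value | y∈
      ... | no y≢v | no vy≢ | here y≡v = contradiction y≡v y≢v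
      ... | no y≢v | no vy≢ | there y∈xs with x ≟ v | adj G v x Bool.≟ not value | x∈
      ...   | yes refl | _      | _          = trans (¬-not vy≢) (not-involutive _)
      ...   | no x≢v   | yes vx | here x≡v   = contradiction x≡v x≢v
      ...   | no x≢v   | yes vx | there x∈xs = trans
        (¬-not λ xy → ¬h (lose x∈xs (vx , lose y∈xs (trans (¬-not vy≢) (not-involutive _) , xy))))
        (not-involutive _)

    -- Seinsche's theorem on cographs, with the vertices inserted one at a time and repetitions in
    -- the list absorbed.
    split : ∀ x xs → (∀ {y} → y ∈ x ∷ xs → y ≡ x) ⊎ Split (x ∷ xs)
    split x []       = inj₁ λ { (here eq) → eq }
    split v (x ∷ xs) with member? _≟_ v (x ∷ xs) | split x xs
    ... | yes v∈ | inj₁ h = inj₁ λ { (here eq) → eq ; (there y∈) → trans (h y∈) (sym (h v∈)) }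
    ... | yes v∈ | inj₂ S = inj₂ record
      { side   = side
      ; value  = value
      ; left   = let w , w∈ , e = left in w , there w∈ , e
      ; right  = let w , w∈ , e = right in w , there w∈ , e
      ; across = λ x∈ y∈ → across (absorb x∈) (absorb y∈) }
      where
      open Split S

      absorb : ∀ {w} → w ∈ v ∷ x ∷ xs → w ∈ x ∷ xs
      absorb (here refl) = v∈
      absorb (there w∈)  = w∈
    ... | no v∉  | inj₁ h = inj₂ (isolate (adj G v x) (x , here refl) v∉ λ w∈ → cong (adj G v) (h w∈))
    ... | no v∉  | inj₂ S = inj₂ (extend v∉ S)

    -- Every nonempty vertex list is represented.

    module _ (free : Free G) where

      represent-singleton : ∀ {x xs} → x ∈ xs → (∀ {y} → y ∈ xs → y ≡ x) → Represented (_∈ xs)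
      represent-singleton {x} {xs} x∈ all≡ =
        -- The first class is that of `κ 1`: the vertex may go to either part of the partition.
        _ , here refl , _ , here refl , single x∈ , independent ∷ complete₁ ∷ []
        where
        same : ∀ {y z} → y ∈ xs → z ∈ xs → y ≡ z
        same y∈ z∈ = trans (all≡ y∈) (sym (all≡ z∈))

        independent : Admits (_∈ xs) (empty , 1)
        independent = (λ _ → false) , (λ { (_ , ()) }) , λ v (v∈ , _) w ((w∈ , _) , vw) →
          case trans (sym vw) (trans (cong (adj G v) (same w∈ v∈)) (irrefl G v)) of λ ()

        complete₁ : Admits (_∈ xs) (clique , 0)
        complete₁ = (λ _ → true) , (λ (y∈ , _) (z∈ , _) y≢z → contradiction (same y∈ z∈) y≢z)
                  , λ { _ (_ , ()) }

      -- Each side of a split omits a vertex of the other side, so its list is strictly shorter.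
      represent : ∀ {x} xs → x ∈ xs → Acc _<_ (length xs) → Represented (_∈ xs)
      represent (x ∷ xs) _ (acc rec) with split x xs
      ... | inj₁ all≡ = represent-singleton (here refl) all≡
      ... | inj₂ S    = represented-bisection free bisection (half true right left) (half false left right)
        where
        open Split S

        part : Bool → List V
        part b = filter (λ v → side v Bool.≟ b) (x ∷ xs)

        half : ∀ b → (∃ λ v → v ∈ x ∷ xs × side v ≡ not b) → (∃ λ v → v ∈ x ∷ xs × side v ≡ b) →
               Represented (_∈ part b)
        half b (u , u∈ , su) (v , v∈ , sv) = represent (part b) (∈-filter⁺ (λ v → side v Bool.≟ b) v∈ sv)
          (rec (filter-notAll (λ v → side v Bool.≟ b) (x ∷ xs) (lose u∈ λ e → not-¬ e su)))

        member : ∀ b {v} → v ∈ part b → v ∈ x ∷ xs × side v ≡ b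
        member b = ∈-filter⁻ (λ v → side v Bool.≟ b) {xs = x ∷ xs}

        bisection : Bisection value (_∈ x ∷ xs) (_∈ part true) (_∈ part false)
        bisection = record
          { side  = side
          ; left  = ∈-filter⁺ (λ v → side v Bool.≟ true)
          ; right = ∈-filter⁺ (λ v → side v Bool.≟ false)
          ; Q⊆P   = proj₁ ∘ member true
          ; R⊆P   = proj₁ ∘ member false
          ; link  = λ y∈ z∈ →
              let y∈′ , sy = member true y∈ ; z∈′ , sz = member false z∈ in
              (λ { refl → not-¬ sy sz }) , across y∈′ z∈′ sy sz }

-- Translation between partitions and profiles.

module _ (G : Graph) where

  private
    V = Fin (size G)

  edge-link : ∀ {x y} → adj G x y ≡ true → Link G true (_≡ x) (_≡ y)
  edge-link xy refl refl = (λ { refl → case trans (sym xy) (irrefl G _) of λ () }) , xy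

  -- A failure of transitivity at `x`, `y`, `z` is an induced path with centre `y`.
  ¬P₃⇒cluster : ∀ A → ¬ ContainsIn G A (P 3) → HasShape G cluster (λ v → A v ≡ true)
  ¬P₃⇒cluster A h {x} {y} {z} px py pz x≢z xy yz with adj G x z in xz
  ... | true  = refl
  ... | false = contradiction (Copy⇒ContainsIn G A (realise G path copy)) h
    where
    copy : _⊑_ G (tree path) (λ v → A v ≡ true)
    copy = node {Q = _≡ y} {R = λ v → v ≡ x ⊎ v ≡ z} (single refl)
      (node {Q = _≡ x} {R = _≡ z} (single refl) (single refl) (λ { refl refl → x≢z , xz }) inj₁ inj₂)
      (λ { p (inj₁ q) → Link-sym G (edge-link xy) p q ; p (inj₂ q) → edge-link yz p q })
      (λ { refl → py }) (λ { (inj₁ refl) → px ; (inj₂ refl) → pz })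

  ¬K₃⇒triangleFree : ∀ A → ¬ ContainsIn G (not ∘ A) (K 3) → CliqueFree G 2 (λ v → A v ≡ false)
  ¬K₃⇒triangleFree A h x px y (py , xy) z ((pz , xz) , yz) =
    h (Copy⇒ContainsIn G (not ∘ A) (realise G (κ 3) copy))
    where
    copy : _⊑_ G (complete 3) (λ v → not (A v) ≡ true)
    copy = node {Q = _≡ x} {R = λ v → v ≡ y ⊎ v ≡ z} (single refl)
      (node {Q = _≡ y} {R = _≡ z} (single refl) (single refl) (edge-link yz) inj₁ inj₂)
      (λ { p (inj₁ q) → edge-link xy p q ; p (inj₂ q) → edge-link xz p q })
      (λ { refl → cong not px }) (λ { (inj₁ refl) → cong not py ; (inj₂ refl) → cong not pz })

  -- Every shape implies `cluster`, and clique number at most 2 excludes triangles.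
  admits⇒partitionable : ∀ {s k} → k ≤ 2 → Admits G (_∈ allFin (size G)) (s , k) → Partitionable G
  admits⇒partitionable {s} k≤2 (A , shape , free) = A , noP₃ , noK₃
    where
    noP₃ : ¬ ContainsIn G A (P 3)
    noP₃ (f , f-inj , inside , pres) = case trans (pres 0F 2F) f0f2 of λ ()
      where
      pattern 0F = zero
      pattern 1F = suc zero
      pattern 2F = suc (suc zero)

      f0f2 : adj G (f 0F) (f 2F) ≡ true
      f0f2 = HasShape-mono G s cluster (≤ˢ-cluster s) shape
        (∈-allFin _ , inside 0F) (∈-allFin _ , inside 1F) (∈-allFin _ , inside 2F)
        (λ e → case f-inj e of λ ()) (sym (pres 0F 1F)) (sym (pres 1F 2F))

    noK₃ : ¬ ContainsIn G (not ∘ A) (K 3)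
    noK₃ (f , f-inj , inside , pres) =
      CliqueFree-mono G k≤2 free
        (f 0F) (member 0F) (f 1F) (member 1F , sym (pres 0F 1F))
        (f 2F) ((member 2F , sym (pres 0F 2F)) , sym (pres 1F 2F))
      where
      pattern 0F = zero
      pattern 1F = suc zero
      pattern 2F = suc (suc zero)

      member : ∀ i → f i ∈ allFin (size G) × A (f i) ≡ false
      member i = ∈-allFin _ , not-injective (inside i)

  -- Refuting all labellings by backtracking.

  bent triangle : V → V → V → Bool
  bent x y z     = adj G x y ∧ adj G y z ∧ not (adj G x z) ∧ not (does (x ≟ z))
  triangle x y z = adj G x y ∧ adj G x z ∧ adj G y z

  -- The new vertex can be an end or the centre of the path, whereas its position in a triangle is
  -- immaterial.
  completesPath completesTriangle : V → List V → Bool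
  completesPath v as     = any (λ x → any (λ y → bent v x y ∨ bent x v y) as) as
  completesTriangle v bs = any (λ x → any (triangle v x) bs) bs

  -- Backtracking over the labels of the listed vertices, as and bs being already labelled.
  refuted : List V → List V → List V → Bool
  refuted []       as bs = false
  refuted (v ∷ vs) as bs = (completesPath v as ∨ refuted vs (v ∷ as) bs)
                         ∧ (completesTriangle v bs ∨ refuted vs as (v ∷ bs))

  module _ (A : V → Bool)
           (shape : HasShape G cluster (λ v → A v ≡ true))
           (free : CliqueFree G 2 (λ v → A v ≡ false)) where

    ¬bent : ∀ {x y z} → A x ≡ true → A y ≡ true → A z ≡ true → ¬ T (bent x y z)
    ¬bent {x} {y} {z} px py pz h with adj G x y in xy | adj G y z in yz | adj G x z in xz | x ≟ z
    ... | true | true | false | no x≢z = case trans (sym xz) (shape px py pz x≢z xy yz) of λ ()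

    ¬triangle : ∀ {x y z} → A x ≡ false → A y ≡ false → A z ≡ false → ¬ T (triangle x y z)
    ¬triangle {x} {y} {z} px py pz h with adj G x y in xy | adj G x z in xz | adj G y z in yz
    ... | true | true | true = free x px y (py , xy) z ((pz , xz) , yz)

    ¬completesPath : ∀ {v as} → A v ≡ true → All (λ x → A x ≡ true) as → ¬ T (completesPath v as)
    ¬completesPath {v} {as} pv pas h
      with x , x∈ , h₁ ← any-find (λ x → any (λ y → bent v x y ∨ bent x v y) as) {as} h
      with y , y∈ , h₂ ← any-find (λ y → bent v x y ∨ bent x v y) {as} h₁
      with px ← All.lookup pas x∈ | py ← All.lookup pas y∈
      with Equivalence.to (T-∨ {bent v x y}) h₂
    ... | inj₁ b = ¬bent pv px py b
    ... | inj₂ b = ¬bent px pv py b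

    ¬completesTriangle : ∀ {v bs} → A v ≡ false → All (λ x → A x ≡ false) bs → ¬ T (completesTriangle v bs)
    ¬completesTriangle {v} {bs} pv pbs h
      with x , x∈ , h₁ ← any-find (λ x → any (triangle v x) bs) {bs} h
      with y , y∈ , h₂ ← any-find (triangle v x) {bs} h₁
      = ¬triangle pv (All.lookup pbs x∈) (All.lookup pbs y∈) h₂

    -- The labelling `A` itself picks a branch of the search tree: a completed path or triangle
    -- contradicts `A`, and the end of the list is never refuted.
    ¬refuted : ∀ vs {as bs} → All (λ x → A x ≡ true) as → All (λ x → A x ≡ false) bs →
               ¬ T (refuted vs as bs)
    ¬refuted (v ∷ vs) {as} {bs} pas pbs h with A v in av | ∧-split {completesPath v as ∨ _} h
    ... | true  | h₁ , _ = [ ¬completesPath av pas , ¬refuted vs (av ∷ pas) pbs ]′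
                             (Equivalence.to (T-∨ {completesPath v as}) h₁)
    ... | false | _ , h₂ = [ ¬completesTriangle av pbs , ¬refuted vs pas (av ∷ pbs) ]′
                             (Equivalence.to (T-∨ {completesTriangle v bs}) h₂)

-- The two directions of the characterisation.

unpartitionable : Graph → Bool
unpartitionable H = refuted H (allFin (size H)) [] []

obstructions-refuted : T (all (unpartitionable ∘ graph) obstructions)
obstructions-refuted = tt

-- Every class lists a profile that is already a partition of the required kind.
classes-partitionable : T (all (λ K → any (λ p → proj₂ p ≤ᵇ 2) (proj₁ K)) classes)
classes-partitionable = tt

-- An embedding pulls the labelling back to the obstruction, where backtracking has refuted every
-- labelling.
partitionable⇒free : ∀ G → Partitionable G → Free G
partitionable⇒free G (A , noP₃ , noK₃) =
  All.map (λ {o} h → excluded (graph o) h)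
    (all⁺ (unpartitionable ∘ graph) obstructions obstructions-refuted)
  where
  excluded : ∀ H → T (unpartitionable H) → ¬ Contains G H
  excluded H h (f , f-inj , pres) = ¬refuted H (A ∘ f) shape free (allFin (size H)) [] [] h
    where
    shape : HasShape H cluster (λ v → A (f v) ≡ true)
    shape px py pz x≢z xy yz = trans (pres _ _)
      (¬P₃⇒cluster G A noP₃ px py pz (x≢z ∘ f-inj) (trans (sym (pres _ _)) xy) (trans (sym (pres _ _)) yz))

    free : CliqueFree H 2 (λ v → A (f v) ≡ false)
    free x px y (py , xy) z ((pz , xz) , yz) =
      ¬K₃⇒triangleFree G A noK₃ (f x) px (f y) (py , trans (sym (pres _ _)) xy)
        (f z) ((pz , trans (sym (pres _ _)) xz) , trans (sym (pres _ _)) yz)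

free⇒partitionable : ∀ G → IsCograph G → Free G → Partitionable G
free⇒partitionable G cograph free with any? (λ _ → yes tt) (allFin (size G))
-- The graph without vertices has no representative; there is no room for the first vertex of `P 3`
-- or `K 3`.
... | no none = (λ _ → true) , (λ (f , _) → none (lose (∈-allFin (f zero)) tt))
                              , (λ (f , _) → none (lose (∈-allFin (f zero)) tt))
... | yes h
  with v , v∈ , _ ← find h
  with K , K∈ , _ , _ , _ , admits ← represent G cograph free (allFin (size G)) v∈ (<-wellFounded _)
  with (s , k) , p∈ , k≤2 ← any-find (λ p → proj₂ p ≤ᵇ 2) {proj₁ K}
         (All.lookup (all⁺ (λ K → any (λ p → proj₂ p ≤ᵇ 2) (proj₁ K)) classes classes-partitionable) K∈)
  = admits⇒partitionable G (≤ᵇ⇒≤ k 2 k≤2) (All.lookup admits p∈)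

HFree⇒free : ∀ G → HFree G → Free G
HFree⇒free G (h₁ , h₂ , h₃ , h₄ , h₅ , h₆ , h₇ , h₈ , h₉ , h₁₀ , h₁₁ , h₁₂ , h₁₃ , h₁₄ , h₁₅ , h₁₆ , h₁₇) =
  h₁ ∷ h₂ ∷ h₃ ∷ h₄ ∷ h₅ ∷ h₆ ∷ h₇ ∷ h₈ ∷ h₉ ∷ h₁₀ ∷ h₁₁ ∷ h₁₂ ∷ h₁₃ ∷ h₁₄ ∷ h₁₅ ∷ h₁₆ ∷ h₁₇ ∷ []

free⇒HFree : ∀ G → Free G → HFree G
free⇒HFree G (h₁ ∷ h₂ ∷ h₃ ∷ h₄ ∷ h₅ ∷ h₆ ∷ h₇ ∷ h₈ ∷ h₉ ∷ h₁₀ ∷ h₁₁ ∷ h₁₂ ∷ h₁₃ ∷ h₁₄ ∷ h₁₅ ∷ h₁₆ ∷ h₁₇ ∷ []) =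
  h₁ , h₂ , h₃ , h₄ , h₅ , h₆ , h₇ , h₈ , h₉ , h₁₀ , h₁₁ , h₁₂ , h₁₃ , h₁₄ , h₁₅ , h₁₆ , h₁₇

theorem2 : (G : Graph) → IsCograph G → (Partitionable G ⇔ HFree G)
theorem2 G cograph = mk⇔ (free⇒HFree G ∘ partitionable⇒free G)
                         (free⇒partitionable G cograph ∘ HFree⇒free G)
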